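{- Consider SALIQUOT. Then $\mathcal{SG}(0)=0$. Suppose that $n>0$ and let $n=2^{k}m$, where $2\nmid m$ and $k\ge 0$. Then $\mathcal{SG}(n)= v(n)+1=k+1$.
   Context: SALIQUOT is the impartial normal-play game on the nonnegative integers where from $n$ a player subtracts a positive divisor of $n$, i.e. $\mathrm{opt}(n)=\{n-d: d\mid n,\ d>0\}$ (so $0$ has no options); the player unable to move loses. $\mathcal{SG}$ denotes the Sprague-Grundy value, defined by the mex rule. $v(n)$ is the 2-adic valuation of $n$. -}

module Defs where

open import Data.List.Base using (List; map; filter; upTo)
open import Data.List.Extrema.Nat using (max; xs≤max)
open import Data.List.Membership.DecPropositional using () renaming (_∈?_ to mem?)
open import Data.List.Membership.Propositional using (_∈_; _∉_; mapWith∈)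
open import Data.List.Membership.Propositional.Properties using (∈-map⁻; ∈-map⁺; ∈-filter⁻; ∈-filter⁺; ∈-upTo⁺; ∈-upTo⁻; mapWith∈-cong; mapWith∈≗map)
open import Data.List.Relation.Unary.All using (lookup)
open import Data.Nat.Base using (ℕ; zero; suc; _+_; _∸_; _^_; _≤_; _<_; _>_; z≤n; s≤s; NonZero)
open import Data.Nat.Divisibility using (_∣_; _∣?_; ∣⇒≤; 1∣_)
open import Data.Nat.Induction using (<-wellFounded; <-rec)
open import Data.Nat.Properties using (_≟_; ≤-trans; <-irrefl; m<1+n⇒m<n∨m≡n; ∸-monoʳ-<; m∸n+n≡m; m≤n+m; m+n∸n≡m; +-suc; m≤n⇒m<n∨m≡n; ≤-pred; +-identityʳ; +-mono-≤; m^n>0)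
open import Data.Product.Base using (∃; _×_; _,_; proj₁)
open import Data.Sum.Base using (inj₁; inj₂)
open import Function.Bundles using (_⇔_; mk⇔; module Equivalence)
open import Induction.WellFounded using (module FixPoint)
open import Relation.Binary.PropositionalEquality using (_≡_; refl; sym; trans; cong; subst)
open import Relation.Nullary.Decidable.Core using (yes; no)
open import Relation.Nullary.Negation.Core using (contradiction)

IsMex : List ℕ → ℕ → Set
IsMex xs m = m ∉ xs × (∀ j → j < m → j ∈ xs)

mex∃ : (xs : List ℕ) → ∃ (IsMex xs)
mex∃ xs = search (suc (max 0 xs)) 0 (λ _ ())
            (λ b∈ → <-irrefl refl (bounded b∈))
  where
  bounded : ∀ {x} → x ∈ xs → x < suc (max 0 xs) + 0
  bounded x∈ = s≤s (subst (_ ≤_) (sym (+-identityʳ _)) (lookup (xs≤max 0 xs) x∈))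

  search : ∀ gap i → (∀ j → j < i → j ∈ xs) → gap + i ∉ xs → ∃ (IsMex xs)
  search zero      i below i∉ = i , i∉ , below
  search (suc gap) i below top∉ with mem? _≟_ i xs
  ... | no i∉  = i , i∉ , below
  ... | yes i∈ = search gap (suc i) below′ (subst (_∉ xs) (sym (+-suc gap i)) top∉)
    where
    below′ : ∀ j → j < suc i → j ∈ xs
    below′ j j<1+i with m<1+n⇒m<n∨m≡n j<1+i
    ... | inj₁ j<i  = below j j<i
    ... | inj₂ refl = i∈

mex : List ℕ → ℕ
mex xs = proj₁ (mex∃ xs)

module SpragueGrundy
  (opt : ℕ → List ℕ)
  (opt-< : ∀ {n p} → p ∈ opt n → p < n)
  where

  private
    step : ∀ n → (∀ {p} → p < n → ℕ) → ℕ
    step n sg = mex (mapWith∈ (opt n) (λ p∈ → sg (opt-< p∈)))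

    step-ext : ∀ n {f g : ∀ {p} → p < n → ℕ} →
               (∀ {p} (p<n : p < n) → f p<n ≡ g p<n) → step n f ≡ step n g
    step-ext n eq = cong mex (mapWith∈-cong (opt n) _ _ (λ p∈ → eq (opt-< p∈)))

  SG : ℕ → ℕ
  SG = <-rec (λ _ → ℕ) step

  SG-mex : ∀ n → SG n ≡ mex (map SG (opt n))
  SG-mex n = trans (FixPoint.unfold-wfRec <-wellFounded (λ _ → ℕ) step step-ext)
                   (cong mex (mapWith∈≗map SG (opt n)))

-- For n > 0 the bound d ≤ n is automatic; at n = 0 it excludes every d > 0
-- (all of which divide 0), so that opt 0 is empty.
divisors : ℕ → List ℕ
divisors n = filter (_∣? n) (map suc (upTo n))

∈-divisors : ∀ n d → d ∈ divisors n ⇔ (d > 0 × d ∣ n × d ≤ n)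
∈-divisors n d = mk⇔ to from
  where
  to : d ∈ divisors n → d > 0 × d ∣ n × d ≤ n
  to d∈ with ∈-filter⁻ (_∣? n) {xs = map suc (upTo n)} d∈
  ... | d∈′ , d∣n with ∈-map⁻ suc d∈′
  ... | i , i∈ , refl = s≤s z≤n , d∣n , ∈-upTo⁻ i∈

  from : d > 0 × d ∣ n × d ≤ n → d ∈ divisors n
  from (s≤s _ , d∣n , d≤n) = ∈-filter⁺ (_∣? n) (∈-map⁺ suc (∈-upTo⁺ d≤n)) d∣n

opt : ℕ → List ℕ
opt n = map (n ∸_) (divisors n)

opt-< : ∀ {n p} → p ∈ opt n → p < n
opt-< {n} p∈ with ∈-map⁻ (n ∸_) p∈
... | d , d∈ , refl with Equivalence.to (∈-divisors n d) d∈
... | d>0 , _ , d≤n = ∸-monoʳ-< {n} {d} {0} d>0 d≤n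

∈-opt : ∀ n p → p ∈ opt n ⇔ (∃ λ d → d > 0 × d ∣ n × p + d ≡ n)
∈-opt n p = mk⇔ to from
  where
  to : p ∈ opt n → ∃ λ d → d > 0 × d ∣ n × p + d ≡ n
  to p∈ with ∈-map⁻ (n ∸_) p∈
  ... | d , d∈ , refl with Equivalence.to (∈-divisors n d) d∈
  ... | d>0 , d∣n , d≤n = d , d>0 , d∣n , m∸n+n≡m d≤n

  from : (∃ λ d → d > 0 × d ∣ n × p + d ≡ n) → p ∈ opt n
  from (d , d>0 , d∣n , refl) =
    subst (_∈ opt (p + d)) (m+n∸n≡m p d)
      (∈-map⁺ ((p + d) ∸_) (Equivalence.from (∈-divisors (p + d) d)
        (d>0 , d∣n , m≤n+m d p)))

open SpragueGrundy opt opt-< public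

IsValuation₂ : ℕ → ℕ → Set
IsValuation₂ n k = 2 ^ k ∣ n × (∀ j → 2 ^ j ∣ n → j ≤ k)

valuation∃ : ∀ n .{{_ : NonZero n}} → ∃ (IsValuation₂ n)
valuation∃ n = search n (λ j 2^j∣n → ≤-trans (j≤2^j j) (∣⇒≤ 2^j∣n))
  where
  j≤2^j : ∀ j → j ≤ 2 ^ j
  j≤2^j zero    = z≤n
  j≤2^j (suc j) = +-mono-≤ (m^n>0 2 j) (subst (j ≤_) (sym (+-identityʳ (2 ^ j))) (j≤2^j j))

  search : ∀ k → (∀ j → 2 ^ j ∣ n → j ≤ k) → ∃ (IsValuation₂ n)
  search zero    above = 0 , 1∣ n , above
  search (suc k) above with 2 ^ suc k ∣? n
  ... | yes 2^k∣n = suc k , 2^k∣n , above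
  ... | no  2^k∤n = search k above′
    where
    above′ : ∀ j → 2 ^ j ∣ n → j ≤ k
    above′ j 2^j∣n with m≤n⇒m<n∨m≡n (above j 2^j∣n)
    ... | inj₁ j<1+k = ≤-pred j<1+k
    ... | inj₂ refl  = contradiction 2^j∣n 2^k∤n

v : ∀ n .{{_ : NonZero n}} → ℕ
v n = proj₁ (valuation∃ n)

{-# OPTIONS --safe #-}

-- The options of n are the c d with n = (c + 1) d. If 2^k is the exact power of 2 in n, then for j < k
-- the choice d = 2^j makes c + 1 even, so c is odd and v(c d) = j. No option has v(c d) = k: then 2^k
-- divides d = n − c d, and as c or c + 1 is even, 2^(k+1) divides c d or n. Together with the option 0,
-- the options of n thus realise the values 0, …, k and miss k + 1.

module Submission where

open import Defs
open import Data.List.Base using (List; map)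
open import Data.List.Membership.Propositional using (_∈_; _∉_)
open import Data.List.Membership.Propositional.Properties using (∈-map⁺; ∈-map⁻)
open import Data.List.Properties using (map-cong-local)
open import Data.List.Relation.Unary.All using (tabulate)
open import Data.Nat.Base using (ℕ; zero; suc; _+_; _*_; _^_; _≤_; _<_; _>_; s≤s; z<s; s<s⁻¹; NonZero)
open import Data.Nat.Coprimality using (Coprime; coprime-+; 1-coprimeTo)
open import Data.Nat.Divisibility using (_∣_; _∤_; divides-refl; ∣-refl; ∣-trans; _∣0; 1∣_; n∣m*n; *-pres-∣; *-monoʳ-∣; *-cancelʳ-∣; ∣m+n∣m⇒∣n; ∣m∣n⇒∣m+n)
open import Data.Nat.Induction using (<-rec)
open import Data.Nat.Properties using (<-cmp; <⇒≤; ≤-antisym; ≮⇒≥; n≮n; +-comm; *-comm; suc-injective; m^n>0; m^n≢0)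
open import Data.Product.Base using (∃; ∃₂; _×_; _,_; proj₁; proj₂)
open import Data.Sum.Base using (_⊎_; inj₁; inj₂)
open import Function.Base using (case_of_)
open import Function.Bundles using (module Equivalence)
open import Relation.Binary.Definitions using (tri<; tri≈; tri>)
open import Relation.Binary.PropositionalEquality using (_≡_; refl; sym; trans; cong; subst; module ≡-Reasoning)
open import Relation.Nullary.Negation.Core using (¬_; contradiction)

open ≡-Reasoning

IsMex-unique : ∀ {xs m n} → IsMex xs m → IsMex xs n → m ≡ n
IsMex-unique {m = m} {n} (m∉ , below-m) (n∉ , below-n) with <-cmp m n
... | tri< m<n _ _ = contradiction (below-n m m<n) m∉
... | tri≈ _ m≡n _ = m≡n
... | tri> _ _ n<m = contradiction (below-m n n<m) n∉

mex-unique : ∀ {xs m} → IsMex xs m → mex xs ≡ m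
mex-unique {xs} = IsMex-unique (proj₂ (mex∃ xs))

module _ (options : ℕ → List ℕ) (options-< : ∀ {n p} → p ∈ options n → p < n) where

  private module Game = SpragueGrundy options options-<

  SG-unique : ∀ {g} → (∀ n → IsMex (map g (options n)) (g n)) → ∀ n → Game.SG n ≡ g n
  SG-unique {g} g-isMex = <-rec (λ n → Game.SG n ≡ g n) step
    where
    step : ∀ n → (∀ {p} → p < n → Game.SG p ≡ g p) → Game.SG n ≡ g n
    step n ih = begin
      Game.SG n                     ≡⟨ Game.SG-mex n ⟩
      mex (map Game.SG (options n)) ≡⟨ cong mex map-SG≡map-g ⟩
      mex (map g (options n))       ≡⟨ mex-unique (g-isMex n) ⟩
      g n                           ∎
      where
      map-SG≡map-g : map Game.SG (options n) ≡ map g (options n)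
      map-SG≡map-g = map-cong-local (tabulate λ p∈ → ih (options-< p∈))

^-monoʳ-∣ : ∀ m {j k} → j ≤ k → m ^ j ∣ m ^ k
^-monoʳ-∣ m {zero}          _         = 1∣ _
^-monoʳ-∣ m {suc j} {suc k} (s≤s j≤k) = *-monoʳ-∣ m (^-monoʳ-∣ m j≤k)

coprime-suc : ∀ n → Coprime (suc n) n
coprime-suc n = subst (λ m → Coprime m n) (+-comm n 1) (coprime-+ (1-coprimeTo n))

2∣1+n⇒2∤n : ∀ {n} → 2 ∣ suc n → 2 ∤ n
2∣1+n⇒2∤n {n} 2∣1+n 2∣n with () ← coprime-suc n (2∣1+n , 2∣n)

2∣n⊎2∣1+n : ∀ n → 2 ∣ n ⊎ 2 ∣ suc n
2∣n⊎2∣1+n zero = inj₁ (2 ∣0)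
2∣n⊎2∣1+n (suc n) with 2∣n⊎2∣1+n n
... | inj₁ 2∣n   = inj₂ (∣m∣n⇒∣m+n (∣-refl {2}) 2∣n)
... | inj₂ 2∣1+n = inj₁ 2∣1+n

v-isValuation₂ : ∀ n .{{_ : NonZero n}} → IsValuation₂ n (v n)
v-isValuation₂ n = proj₂ (valuation∃ n)

IsValuation₂-unique : ∀ {n j k} → IsValuation₂ n j → IsValuation₂ n k → j ≡ k
IsValuation₂-unique (2^j∣n , max-j) (2^k∣n , max-k) = ≤-antisym (max-k _ 2^j∣n) (max-j _ 2^k∣n)

IsValuation₂⇒2^1+k∤n : ∀ {n k} → IsValuation₂ n k → 2 ^ suc k ∤ n
IsValuation₂⇒2^1+k∤n {k = k} (_ , max-k) 2^1+k∣n = n≮n k (max-k (suc k) 2^1+k∣n)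

¬IsValuation₂-0 : ∀ {k} → ¬ IsValuation₂ 0 k
¬IsValuation₂-0 val = IsValuation₂⇒2^1+k∤n val (_ ∣0)

IsValuation₂-odd*2^k : ∀ {m} k → 2 ∤ m → IsValuation₂ (m * 2 ^ k) k
IsValuation₂-odd*2^k {m} k 2∤m = n∣m*n m , λ j 2^j∣m*2^k → ≮⇒≥ λ k<j →
  2∤m (*-cancelʳ-∣ (2 ^ k) {{m^n≢0 2 k}} (∣-trans (^-monoʳ-∣ 2 k<j) 2^j∣m*2^k))

v-2^k*odd : ∀ n .{{_ : NonZero n}} k m → n ≡ 2 ^ k * m → 2 ∤ m → v n ≡ k
v-2^k*odd n k m n≡2^k*m 2∤m = IsValuation₂-unique (v-isValuation₂ n)
  (subst (λ x → IsValuation₂ x k) m*2^k≡n (IsValuation₂-odd*2^k k 2∤m))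
  where
  m*2^k≡n : m * 2 ^ k ≡ n
  m*2^k≡n = trans (*-comm m (2 ^ k)) (sym n≡2^k*m)

consecutive-multiples-valuation-≢ : ∀ c d {k} → IsValuation₂ (c * d) k → ¬ IsValuation₂ (suc c * d) k
consecutive-multiples-valuation-≢ c d {k} val val⁺ = case 2∣n⊎2∣1+n c of λ
  { (inj₁ 2∣c)   → IsValuation₂⇒2^1+k∤n val (*-pres-∣ 2∣c 2^k∣d)
  ; (inj₂ 2∣1+c) → IsValuation₂⇒2^1+k∤n val⁺ (*-pres-∣ 2∣1+c 2^k∣d)
  }
  where
  2^k∣d : 2 ^ k ∣ d
  2^k∣d = ∣m+n∣m⇒∣n (subst (2 ^ k ∣_) (+-comm d (c * d)) (proj₁ val⁺)) (proj₁ val)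

preceding-multiple-of-smaller-valuation : ∀ {n j k} → IsValuation₂ n k → j < k →
  ∃ λ c → n ≡ suc c * 2 ^ j × IsValuation₂ (c * 2 ^ j) j
preceding-multiple-of-smaller-valuation {j = j} val@(2^k∣n , _) j<k
  with ∣-trans (^-monoʳ-∣ 2 (<⇒≤ j<k)) 2^k∣n
... | divides-refl zero    = contradiction val ¬IsValuation₂-0
... | divides-refl (suc c) = c , refl , IsValuation₂-odd*2^k j (2∣1+n⇒2∤n 2∣1+c)
  where
  2∣1+c : 2 ∣ suc c
  2∣1+c = *-cancelʳ-∣ (2 ^ j) {{m^n≢0 2 j}} (∣-trans (^-monoʳ-∣ 2 j<k) 2^k∣n)

c*d∈opt-[1+c]*d : ∀ c d → d > 0 → c * d ∈ opt (suc c * d)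
c*d∈opt-[1+c]*d c d d>0 =
  Equivalence.from (∈-opt (suc c * d) (c * d)) (d , d>0 , n∣m*n (suc c) , +-comm (c * d) d)

∈-opt⇒consecutive-multiples : ∀ {n p} → p ∈ opt n → ∃₂ λ c d → p ≡ c * d × n ≡ suc c * d
∈-opt⇒consecutive-multiples {n} {p} p∈ with Equivalence.to (∈-opt n p) p∈
... | d , _ , d∣p+d , refl with ∣m+n∣m⇒∣n (subst (d ∣_) (+-comm p d) d∣p+d) ∣-refl
...   | divides-refl c = c , d , refl , +-comm (c * d) d

0∈opt : ∀ {n} → n > 0 → 0 ∈ opt n
0∈opt {n} n>0 = Equivalence.from (∈-opt n 0) (n , n>0 , ∣-refl , refl)

option-valuation-≢ : ∀ {n p k} → p ∈ opt n → IsValuation₂ n k → ¬ IsValuation₂ p k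
option-valuation-≢ p∈ val-n val-p with ∈-opt⇒consecutive-multiples p∈
... | c , d , refl , refl = consecutive-multiples-valuation-≢ c d val-p val-n

option-of-smaller-valuation : ∀ {n j k} → IsValuation₂ n k → j < k →
  ∃ λ p → p ∈ opt n × IsValuation₂ p j
option-of-smaller-valuation {j = j} val j<k with preceding-multiple-of-smaller-valuation val j<k
... | c , refl , val-p = c * 2 ^ j , c*d∈opt-[1+c]*d c (2 ^ j) (m^n>0 2 j) , val-p

saliquotValue : ℕ → ℕ
saliquotValue zero      = 0
saliquotValue n@(suc _) = suc (v n)

IsValuation₂⇒saliquotValue≡1+k : ∀ {n k} → IsValuation₂ n k → saliquotValue n ≡ suc k
IsValuation₂⇒saliquotValue≡1+k {zero}      val = contradiction val ¬IsValuation₂-0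
IsValuation₂⇒saliquotValue≡1+k {n@(suc _)} val = cong suc (IsValuation₂-unique (v-isValuation₂ n) val)

saliquotValue≡1+k⇒IsValuation₂ : ∀ n {k} → saliquotValue n ≡ suc k → IsValuation₂ n k
saliquotValue≡1+k⇒IsValuation₂ n@(suc _) value≡1+k =
  subst (IsValuation₂ n) (suc-injective value≡1+k) (v-isValuation₂ n)

saliquotValue-isMex : ∀ n → IsMex (map saliquotValue (opt n)) (saliquotValue n)
saliquotValue-isMex zero      = (λ ()) , λ _ ()
saliquotValue-isMex n@(suc _) = missed , reached
  where
  missed : suc (v n) ∉ map saliquotValue (opt n)
  missed 1+v∈ with ∈-map⁻ saliquotValue 1+v∈
  ... | p , p∈ , 1+v≡value =
    option-valuation-≢ p∈ (v-isValuation₂ n) (saliquotValue≡1+k⇒IsValuation₂ p (sym 1+v≡value))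

  reached : ∀ j → j < suc (v n) → j ∈ map saliquotValue (opt n)
  reached zero    _       = ∈-map⁺ saliquotValue (0∈opt z<s)
  reached (suc j) 1+j<1+v with option-of-smaller-valuation (v-isValuation₂ n) (s<s⁻¹ 1+j<1+v)
  ... | p , p∈ , val-p = subst (_∈ map saliquotValue (opt n))
    (IsValuation₂⇒saliquotValue≡1+k val-p) (∈-map⁺ saliquotValue p∈)

SG≡saliquotValue : ∀ n → SG n ≡ saliquotValue n
SG≡saliquotValue = SG-unique opt opt-< saliquotValue-isMex

mainTheorem2 :
    SG 0 ≡ 0 ×
    (∀ (n : ℕ) .{{_ : NonZero n}} (k m : ℕ) → n ≡ 2 ^ k * m → 2 ∤ m →
      SG n ≡ v n + 1 × v n + 1 ≡ k + 1)
mainTheorem2 = SG≡saliquotValue 0 , λ n k m n≡2^k*m 2∤m →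
  SG≡v+1 n , cong (_+ 1) (v-2^k*odd n k m n≡2^k*m 2∤m)
  where
  SG≡v+1 : ∀ n .{{_ : NonZero n}} → SG n ≡ v n + 1
  SG≡v+1 n@(suc _) = begin
    SG n            ≡⟨ SG≡saliquotValue n ⟩
    saliquotValue n ≡⟨ +-comm 1 (v n) ⟩
    v n + 1         ∎
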